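{- The infinite words $f(h^\omega(0))$ and $f(g(h^\omega(0)))$ are rich.
   Context: Morphisms: $f:\{0,1,2\}^*\to\{0,1\}^*$, $f(0)=0$, $f(1)=01$, $f(2)=011$; $g,h:\{0,1,2\}^*\to\{0,1,2\}^*$, $g(0)=011$, $g(1)=0121$, $g(2)=012121$, $h(0)=01$, $h(1)=02$, $h(2)=022$. $h^\omega(0)=\lim_n h^n(0)$ is the infinite fixed point of $h$ starting with $0$. A finite word of length $n$ is rich if it has $n$ distinct nonempty palindromic factors; an infinite word is rich if all of its finite factors are rich. -}

module Defs where

open import Data.Nat using (ℕ; zero; suc; _+_)
open import Data.Fin using (Fin; zero; suc)
open import Data.List using (List; []; _∷_; _++_; length; reverse; concatMap; map; upTo)
open import Data.List.Membership.Propositional using (_∈_)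
open import Data.List.Relation.Unary.Unique.Propositional using (Unique)
open import Data.Product using (Σ; ∃; ∃-syntax; _×_; _,_)
open import Function.Bundles using (_⇔_)
open import Relation.Binary.PropositionalEquality using (_≡_)
open import Relation.Nullary using (¬_)

Word : Set → Set
Word A = List A

InfWord : Set → Set
InfWord A = ℕ → A

morph : {A B : Set} → (A → List B) → List A → List B
morph σ = concatMap σ

0₃ 1₃ 2₃ : Fin 3
0₃ = zero
1₃ = suc zero
2₃ = suc (suc zero)

0₂ 1₂ : Fin 2
0₂ = zero
1₂ = suc zero

fL : Fin 3 → List (Fin 2)
fL zero = 0₂ ∷ []
fL (suc zero) = 0₂ ∷ 1₂ ∷ []
fL (suc (suc zero)) = 0₂ ∷ 1₂ ∷ 1₂ ∷ []

gL : Fin 3 → List (Fin 3)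
gL zero = 0₃ ∷ 1₃ ∷ 1₃ ∷ []
gL (suc zero) = 0₃ ∷ 1₃ ∷ 2₃ ∷ 1₃ ∷ []
gL (suc (suc zero)) = 0₃ ∷ 1₃ ∷ 2₃ ∷ 1₃ ∷ 2₃ ∷ 1₃ ∷ []

hL : Fin 3 → List (Fin 3)
hL zero = 0₃ ∷ 1₃ ∷ []
hL (suc zero) = 0₃ ∷ 2₃ ∷ []
hL (suc (suc zero)) = 0₃ ∷ 2₃ ∷ 2₃ ∷ []

f : List (Fin 3) → List (Fin 2)
f = morph fL

g : List (Fin 3) → List (Fin 3)
g = morph gL

h : List (Fin 3) → List (Fin 3)
h = morph hL

hPow : ℕ → List (Fin 3)
hPow zero = 0₃ ∷ []
hPow (suc n) = h (hPow n)

nthD : {A : Set} → A → List A → ℕ → A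
nthD d [] _ = d
nthD d (x ∷ xs) zero = x
nthD d (x ∷ xs) (suc i) = nthD d xs i

-- The infinite words f(h^ω(0)) and f(g(h^ω(0))).
-- Since h(0) starts with 0, h^n(0) is a prefix of h^(n+1)(0), and
-- |f(h^(i+1)(0))|, |f(g(h^(i+1)(0)))| > i, so position i of the limit word
-- is position i of the finite word at stage i+1 (the default is never used).
fhω : InfWord (Fin 2)
fhω i = nthD 0₂ (f (hPow (suc i))) i

fghω : InfWord (Fin 2)
fghω i = nthD 0₂ (f (g (hPow (suc i)))) i

IsFactor : {A : Set} → List A → List A → Set
IsFactor {A} u w = ∃[ p ] ∃[ s ] (p ++ u ++ s ≡ w)

IsPalindrome : {A : Set} → List A → Set
IsPalindrome u = reverse u ≡ u

NonEmpty : {A : Set} → List A → Set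
NonEmpty u = ¬ (u ≡ [])

Rich : {A : Set} → List A → Set
Rich {A} w =
  ∃[ L ] (Unique L
         × (∀ (u : List A) → (u ∈ L) ⇔ (NonEmpty u × IsPalindrome u × IsFactor u w))
         × length L ≡ length w)

slice : {A : Set} → InfWord A → ℕ → ℕ → List A
slice x i n = map (λ k → x (i + k)) (upTo n)

RichInf : {A : Set} → InfWord A → Set
RichInf x = ∀ i n → Rich (slice x i n)

{-# OPTIONS --safe #-}
module Submission where

-- A word is rich as soon as every palindromic prefix of a factor that recurs in it extends to a longer
-- palindromic prefix ending no later than the recurrence (Returns anywhere): prepending a letter then
-- creates exactly one new palindrome.
--
-- Each of f, g, h has the form a ↦ 0 q(a) with distinct 0-free palindromes q(a).  A palindrome containing
-- 0 in the image of x is  s̃ φ(v) 0 s  with v a palindrome of x and s a prefix of the blocks q(a) next to v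
-- on both sides.  So returns in the image correspond to returns in x of v flanked by letters from the set
-- of those a for which s is a prefix of q(a).  For f, g, h only four kinds of such sets arise: all
-- letters, {1,2}, singletons and ∅.  A return of v flanked by c's is a return of the palindrome c v c, so
-- the returns of all palindromes and those flanked by {1,2} (Returns nonzero) form a closed system, and
-- it passes from x to h(x)0.  Palindromes without 0 leave finitely many cases, which are decided.

open import Defs
open import Data.Bool using (Bool; true; false)
import Data.Bool.Properties as Bool
open import Data.Empty using (⊥-elim)
open import Data.Fin using (Fin; zero; suc)
import Data.Fin.Properties as Fin
open import Data.List using (List; []; _∷_; [_]; _++_; _∷ʳ_; length; reverse; concatMap; applyUpTo; head; InitLast; initLast; _∷ʳ′_)
import Data.List.Membership.DecPropositional as DecMembership
open import Data.List.Membership.Propositional using (_∈_)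
open import Data.List.Properties
open import Data.List.Relation.Unary.All using (All; []; _∷_)
import Data.List.Relation.Unary.All as All
import Data.List.Relation.Unary.All.Properties as All
open import Data.List.Relation.Unary.AllPairs using ([]; _∷_)
open import Data.List.Relation.Unary.Any using (here; there)
open import Data.Maybe using (Maybe; just; nothing)
import Data.Maybe.Properties as Maybe
open import Data.Nat using (ℕ; zero; suc; _+_; _*_; _≤_; _<_; _≤?_; z≤n; s≤s; s≤s⁻¹)
open import Data.Nat.Properties using (≤-refl; ≤-trans; ≤-reflexive; <-irrefl; <-≤-trans; n≤1+n; m≤m+n; m≤n+m; m≤n⇒∃[o]m+o≡n; +-suc; +-comm; +-identityʳ; +-mono-≤; +-monoʳ-≤; +-monoʳ-<; *-identityʳ; *-monoˡ-≤; m<m*n)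
open import Data.Product using (∃; ∃₂; _×_; _,_; proj₁; proj₂)
open import Data.Sum using (_⊎_; inj₁; inj₂; [_,_]′)
open import Function using (_∘_; case_of_)
open import Function.Bundles using (mk⇔; Equivalence)
open import Relation.Binary.PropositionalEquality using (_≡_; _≢_; _≗_; refl; sym; trans; cong; cong₂; subst; module ≡-Reasoning)
open import Relation.Nullary using (¬_; Dec; yes; no; contradiction; does)
open import Relation.Nullary.Decidable using (map′; _×-dec_; _⊎-dec_; _→-dec_; ¬?; from-yes; dec-true)

-- Comparing two factorizations of one word

module _ {A : Set} where

  ++-compare : ∀ (u w u′ w′ : List A) → u ++ w ≡ u′ ++ w′ →
               (∃₂ λ c n → u′ ≡ u ++ c ∷ n × w ≡ c ∷ n ++ w′) ⊎ (∃ λ n → u ≡ u′ ++ n × w′ ≡ n ++ w)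
  ++-compare []      w []       w′ eq = inj₂ ([] , refl , sym eq)
  ++-compare []      w (c ∷ u′) w′ eq = inj₁ (c , u′ , refl , eq)
  ++-compare (a ∷ u) w []       w′ eq = inj₂ (a ∷ u , refl , sym eq)
  ++-compare (a ∷ u) w (b ∷ u′) w′ eq with ∷-injective eq
  ... | refl , eq′ with ++-compare u w u′ w′ eq′
  ...   | inj₁ (c , n , p , q) = inj₁ (c , n , cong (a ∷_) p , q)
  ...   | inj₂ (n , p , q)     = inj₂ (n , cong (a ∷_) p , q)

  longer-prefix : ∀ (u w u′ w′ : List A) → u ++ w ≡ u′ ++ w′ → length u < length u′ →
                  ∃₂ λ c n → u′ ≡ u ++ c ∷ n × w ≡ c ∷ n ++ w′
  longer-prefix u w u′ w′ eq u<u′ with ++-compare u w u′ w′ eq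
  ... | inj₁ found          = found
  ... | inj₂ (n , refl , _) = contradiction
    (<-≤-trans u<u′ (≤-trans (m≤m+n (length u′) (length n)) (≤-reflexive (sym (length-++ u′)))))
    (<-irrefl refl)

  -- Reversing the longer palindrome turns its prefix `u` into a suffix, and as `d ∷ n` is nonempty
  -- this second occurrence starts after the first letter. Hence at most one palindromic prefix can
  -- be new when a letter is prepended.
  palindromic-prefix-recurs : ∀ {c : A} {y} u n z {d} → IsPalindrome u → IsPalindrome (u ++ d ∷ n) →
                              (u ++ d ∷ n) ++ z ≡ c ∷ y → IsFactor u y
  palindromic-prefix-recurs {c} {y} u n z {d} pal-u pal eq = go (reverse (d ∷ n)) refl
    where
    eq₁ : u ++ d ∷ n ≡ reverse (d ∷ n) ++ u
    eq₁ = trans (sym pal) (trans (reverse-++ u (d ∷ n)) (cong (reverse (d ∷ n) ++_) pal-u))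
    go : ∀ k → reverse (d ∷ n) ≡ k → IsFactor u y
    go []      k≡ = contradiction (trans (cong length (sym k≡)) (length-reverse (d ∷ n))) λ ()
    go (e ∷ k) k≡ = k , z , ∷-injectiveʳ (trans (sym (++-assoc (e ∷ k) u z))
      (trans (cong (_++ z) (sym (trans eq₁ (cong (_++ u) k≡)))) eq))

-- Contexts and the return property

-- A set of admissible neighbouring letters; nothing stands for the boundary of the word.
Context : ℕ → Set
Context n = Maybe (Fin n) → Bool

_⊨_ : ∀ {n} → Context n → Maybe (Fin n) → Set
t ⊨ m = t m ≡ true

anywhere : ∀ {n} → Context n
anywhere _ = true

PalindromicPrefix : ∀ {n} → Context n → ℕ → List (Fin n) → List (Fin n) → Set
PalindromicPrefix t k v r = ∃₂ λ P z → P ++ z ≡ v × IsPalindrome P × k ≤ length P × t ⊨ head (z ++ r)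

-- Here x = p v r, and v has the palindromic border u: v = u w = reverse w′ · u.  Both occurrences of u are
-- flanked by t on either side, and so is the longer palindromic prefix of v (on the left by p).
Returns : ∀ {n} → Context n → List (Fin n) → Set
Returns t x =
  ∀ p y → p ++ y ≡ x → ∀ v r → v ++ r ≡ y → t ⊨ head (reverse p) → t ⊨ head r →
  ∀ u w → u ++ w ≡ v → IsPalindrome u → w ≢ [] → t ⊨ head (w ++ r) →
  ∀ w′ → u ++ w′ ≡ reverse v → t ⊨ head (w′ ++ reverse p) →
  PalindromicPrefix t (suc (length u)) v r

-- Returns imply richness

module Richness {n} (x : List (Fin n)) (returns : Returns anywhere x) where

  open DecMembership (≡-dec (Fin._≟_ {n})) using (_∈?_)

  module _ (p : List (Fin n)) (c : Fin n) (y r : List (Fin n)) (eq : p ++ (c ∷ y) ++ r ≡ x) where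

    -- `Returns` is applied to `c ∷ a ++ u`, which reaches from the start of the prefix to the end
    -- of its recurrence and has `u` as a border.
    recurring-prefix-extends : ∀ u z → u ++ z ≡ c ∷ y → IsPalindrome u → IsFactor u y →
                               PalindromicPrefix anywhere (suc (length u)) (c ∷ y) []
    recurring-prefix-extends u z u++z pal-u (a , b , fac)
      with longer-prefix u z (c ∷ a ++ u) b
             (trans u++z (cong (c ∷_) (trans (sym fac) (sym (++-assoc a u b)))))
             (s≤s (≤-trans (m≤n+m (length u) (length a)) (≤-reflexive (sym (length-++ a)))))
    ... | d , w , cau≡ , _
      with returns p ((c ∷ y) ++ r) eq (c ∷ a ++ u) (b ++ r)
             (cong (c ∷_) (trans (++-assoc a u (b ++ r)) (trans (cong (a ++_) (sym (++-assoc u b r)))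
               (trans (sym (++-assoc a (u ++ b) r)) (cong (_++ r) fac)))))
             refl refl u (d ∷ w) (sym cau≡) pal-u (λ ()) refl
             (reverse (c ∷ a)) (sym (trans (reverse-++ (c ∷ a) u) (cong (_++ reverse (c ∷ a)) pal-u))) refl
    ...   | P , z′ , Pz , pal-P , u<P , _ =
      P , z′ ++ b , trans (sym (++-assoc P z′ b)) (trans (cong (_++ b) Pz) (cong (c ∷_) (trans (++-assoc a u b) fac)))
        , pal-P , u<P , refl

    -- Starting from the single letter `c`, a palindromic prefix is exchanged for a longer one as
    -- long as it recurs in `y`. The list `L` makes recurrence decidable.
    new-palindrome : (L : List (List (Fin n))) →
      (∀ u → u ∈ L → IsFactor u y) →
      (∀ u → NonEmpty u → IsPalindrome u → IsFactor u y → u ∈ L) →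
      ∃₂ λ P z → P ++ z ≡ c ∷ y × NonEmpty P × IsPalindrome P × ¬ IsFactor P y
    new-palindrome L sound complete = search (suc (length y)) [ c ] y refl (λ ()) refl ≤-refl
      where
      search : ∀ fuel P z → P ++ z ≡ c ∷ y → NonEmpty P → IsPalindrome P → suc (length y) < length P + fuel →
               ∃₂ λ P z → P ++ z ≡ c ∷ y × NonEmpty P × IsPalindrome P × ¬ IsFactor P y
      -- Without fuel, the bound would make `P` longer than the word `c ∷ y` of which it is a
      -- prefix.
      search zero P z Pz _ _ y<P = contradiction
        (<-≤-trans y<P (≤-trans (≤-reflexive (+-identityʳ _))
          (≤-trans (m≤m+n (length P) (length z)) (≤-reflexive (trans (sym (length-++ P)) (cong length Pz))))))
        (<-irrefl refl)
      search (suc fuel) P z Pz P≢[] pal y< with P ∈? L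
      ... | no P∉L = P , z , Pz , P≢[] , pal , P∉L ∘ complete P P≢[] pal
      ... | yes P∈L with recurring-prefix-extends P z Pz pal (sound P P∈L)
      ...   | []    , _ , _ , _ , () , _
      ...   | d ∷ Q , z′ , Qz , pal-Q , P<Q , _ = search fuel (d ∷ Q) z′ Qz (λ ()) pal-Q
        (<-≤-trans y< (≤-trans (≤-reflexive (+-suc (length P) fuel)) (+-mono-≤ P<Q (≤-refl {fuel}))))

  rich-factor : ∀ p y r → p ++ y ++ r ≡ x → Rich y
  rich-factor p [] r _ = [] , [] , (λ u → mk⇔ (λ ()) λ { (u≢[] , _ , a , b , eq) → ⊥-elim (u≢[]
    (++-conicalˡ u b (++-conicalʳ a (u ++ b) eq))) }) , refl
  rich-factor p (c ∷ y) r eq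
    with rich-factor (p ∷ʳ c) y r (trans (++-assoc p [ c ] (y ++ r)) eq)
  ... | L , unique , spec , len
    with new-palindrome p c y r eq L
           (λ u u∈L → proj₂ (proj₂ (Equivalence.to (spec u) u∈L)))
           (λ u ne pal fac → Equivalence.from (spec u) (ne , pal , fac))
  ...   | P , z , Pz , P≢[] , pal-P , P∉y =
    P ∷ L , All.¬Any⇒All¬ L (P∉y ∘ factor P) ∷ unique , (λ u → mk⇔ to (from u)) , cong suc len
    where
    factor : ∀ u → u ∈ L → IsFactor u y
    factor u u∈L = proj₂ (proj₂ (Equivalence.to (spec u) u∈L))

    to : ∀ {u} → u ∈ P ∷ L → NonEmpty u × IsPalindrome u × IsFactor u (c ∷ y)
    to (here refl) = P≢[] , pal-P , [] , z , Pz
    to {u} (there u∈L) with Equivalence.to (spec u) u∈L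
    ... | ne , pal , a , b , fac = ne , pal , c ∷ a , b , cong (c ∷_) fac

    from : ∀ u → NonEmpty u × IsPalindrome u × IsFactor u (c ∷ y) → u ∈ P ∷ L
    from u (ne , pal , a ∷ a′ , b , fac) =
      there (Equivalence.from (spec u) (ne , pal , a′ , b , ∷-injectiveʳ fac))
    -- Both `u` and `P` are palindromic prefixes of `c ∷ y`, and the shorter one recurs in `y`. If
    -- that is `u`, it is in `L` already; it cannot be `P`, which is new.
    from u (ne , pal , [] , b , fac) with ++-compare u b P z (trans fac (sym Pz))
    ... | inj₁ (d , k , refl , _) = there (Equivalence.from (spec u)
            (ne , pal , palindromic-prefix-recurs u k z pal pal-P Pz))
    ... | inj₂ ([] , refl , _) = here (++-identityʳ P)
    ... | inj₂ (d ∷ k , refl , _) = contradiction (palindromic-prefix-recurs P k b pal-P pal fac) P∉y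

-- Deciding properties of all factorizations of a finite word

module _ {A : Set} where

  ∀split? : ∀ {P : List A → List A → Set} → (∀ u w → Dec (P u w)) → ∀ x → Dec (∀ u w → u ++ w ≡ x → P u w)
  ∀split? P? [] = map′ (λ { p [] [] refl → p }) (λ all → all [] [] refl) (P? [] [])
  ∀split? P? (a ∷ x) = map′
    (λ { (p , all) [] w refl → p ; (p , all) (b ∷ u) w eq → case ∷-injective eq of λ { (refl , eq′) → all u w eq′ } })
    (λ all → all [] (a ∷ x) refl , λ u w eq → all (a ∷ u) w (cong (a ∷_) eq))
    (P? [] (a ∷ x) ×-dec ∀split? (λ u → P? (a ∷ u)) x)

  ∃split? : ∀ {P : List A → List A → Set} → (∀ u w → Dec (P u w)) → ∀ x → Dec (∃₂ λ u w → u ++ w ≡ x × P u w)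
  ∃split? P? [] = map′ (λ p → [] , [] , refl , p) (λ { ([] , [] , refl , p) → p }) (P? [] [])
  ∃split? P? (a ∷ x) = map′
    [ (λ p → [] , a ∷ x , refl , p) , (λ { (u , w , eq , p) → a ∷ u , w , cong (a ∷_) eq , p }) ]′
    (λ { ([] , w , refl , p) → inj₁ p
       ; (b ∷ u , w , eq , p) → case ∷-injective eq of λ { (refl , eq′) → inj₂ (u , w , eq′ , p) } })
    (P? [] (a ∷ x) ⊎-dec ∃split? (λ u → P? (a ∷ u)) x)

infix 4 _⊨?_
_⊨?_ : ∀ {n} (t : Context n) m → Dec (t ⊨ m)
t ⊨? m = t m Bool.≟ true

module _ {n : ℕ} where

  infix 4 _≟ₗ_
  _≟ₗ_ : (u w : List (Fin n)) → Dec (u ≡ w)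
  _≟ₗ_ = ≡-dec Fin._≟_

  ∀suffix? : ∀ {P : List (Fin n) → Set} → (∀ w → Dec (P w)) → ∀ u x → Dec (∀ w → u ++ w ≡ x → P w)
  ∀suffix? P? []      x  = map′ (λ { p w refl → p }) (λ all → all x refl) (P? x)
  ∀suffix? P? (a ∷ u) [] = yes λ _ ()
  ∀suffix? P? (a ∷ u) (b ∷ x) with a Fin.≟ b
  ... | yes refl = map′ (λ all w → all w ∘ ∷-injectiveʳ) (λ all w → all w ∘ cong (a ∷_)) (∀suffix? P? u x)
  ... | no a≢b   = yes λ w eq → contradiction (∷-injectiveˡ eq) a≢b

  ∀maybe? : ∀ {P : Maybe (Fin n) → Set} → (∀ m → Dec (P m)) → Dec (∀ m → P m)
  ∀maybe? P? = map′ (λ { (p , all) nothing → p ; (p , all) (just a) → all a })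
                    (λ all → all nothing , all ∘ just) (P? nothing ×-dec Fin.all? (P? ∘ just))

  palindromicPrefix? : ∀ t k (v r : List (Fin n)) → Dec (PalindromicPrefix t k v r)
  palindromicPrefix? t k v r = ∃split? (λ P z → reverse P ≟ₗ P ×-dec k ≤? length P ×-dec t ⊨? head (z ++ r)) v

  returns? : ∀ t (x : List (Fin n)) → Dec (Returns t x)
  returns? t = ∀split? λ p → ∀split? λ v r → t ⊨? head (reverse p) →-dec t ⊨? head r →-dec
    ∀split? (λ u w → reverse u ≟ₗ u →-dec ¬? (w ≟ₗ []) →-dec t ⊨? head (w ++ r) →-dec
      ∀suffix? (λ w′ → t ⊨? head (w′ ++ reverse p) →-dec palindromicPrefix? t (suc (length u)) v r)
        u (reverse v)) v

-- Contexts for which the invariant yields returns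

-- The counterpart of `Returns` without a border; the palindromic prefix may be empty. It serves
-- those palindromes of an image that contain no marker and so come from no palindrome of `x`.
Starts : ∀ {n} → Context n → List (Fin n) → Set
Starts t x = ∀ p y → p ++ y ≡ x → ∀ v r → v ++ r ≡ y → t ⊨ head (reverse p) → t ⊨ head r → PalindromicPrefix t 0 v r

nonzero : ∀ {n} → Context (suc n)
nonzero (just (suc _)) = true
nonzero _              = false

Invariant : List (Fin 3) → Set
Invariant x = Returns anywhere x × Returns nonzero x

-- The first alternative leaves the boundary free: `pull nonzero []` for h admits every letter but
-- not the boundary. The second includes the empty context.
Good : Context 3 → Set
Good t = (∀ c → t ⊨ just c) ⊎ (∃ λ c → ∀ m → t ⊨ m → m ≡ just c) ⊎ t ≗ nonzero

good? : ∀ t → Dec (Good t)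
good? t = Fin.all? (λ c → t ⊨? just c)
  ⊎-dec Fin.any? (λ c → ∀maybe? λ m → t ⊨? m →-dec Maybe.≡-dec Fin._≟_ m (just c))
  ⊎-dec ∀maybe? λ m → t m Bool.≟ nonzero m

total-head-++ : ∀ {n} (t : Context n) → (∀ c → t ⊨ just c) → ∀ z {r} → t ⊨ head r → t ⊨ head (z ++ r)
total-head-++ t total []      tr = tr
total-head-++ t total (c ∷ z) tr = total c

reverse-wrap : ∀ {A : Set} (c d : A) P → reverse (c ∷ P ∷ʳ d) ≡ d ∷ reverse P ∷ʳ c
reverse-wrap c d P = trans (unfold-reverse c (P ∷ʳ d)) (cong (_∷ʳ c) (reverse-++ P [ d ]))

-- A palindrome of length at least 2 that starts with `c` also ends with a second `c`. Removing both
-- leaves a palindromic prefix of `v`, and the removed last `c` is the letter that follows it.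
unwrap : ∀ {n} {k} {c : Fin n} {v r} (t : Context n) → t ⊨ just c →
         PalindromicPrefix anywhere (suc (suc k)) (c ∷ v ∷ʳ c) r → PalindromicPrefix t k v (c ∷ r)
unwrap {n} {k} {c} {v} {r} t tc (b ∷ Q , z , eq , pal , s≤s k<Q , _) with initLast Q
unwrap t tc (b ∷ _ , z , eq , pal , s≤s () , _) | []
... | P ∷ʳ′ d = trim (initLast z) (trans (cong (λ e → (P ∷ʳ e) ++ z) (sym d≡c)) (∷-injectiveʳ eq))
  where
  pal′ : d ∷ reverse P ∷ʳ b ≡ b ∷ P ∷ʳ d
  pal′ = trans (sym (reverse-wrap b d P)) pal
  d≡c : d ≡ c
  d≡c = trans (∷-injectiveˡ pal′) (∷-injectiveˡ eq)
  pal-P : IsPalindrome P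
  pal-P = ∷ʳ-injectiveˡ _ P (∷-injectiveʳ pal′)
  k≤P : k ≤ length P
  k≤P = s≤s⁻¹ (≤-trans k<Q (≤-reflexive (trans (length-++ P) (+-comm (length P) 1))))
  trim : ∀ {z} → InitLast z → (P ∷ʳ c) ++ z ≡ v ∷ʳ c → PalindromicPrefix t k v (c ∷ r)
  trim [] e = P , [] , trans (++-identityʳ P) (∷ʳ-injectiveˡ P v (trans (sym (++-identityʳ (P ∷ʳ c))) e))
    , pal-P , k≤P , tc
  trim (z′ ∷ʳ′ e) eq = P , c ∷ z′ , ∷ʳ-injectiveˡ (P ++ c ∷ z′) v
      (trans (++-assoc P (c ∷ z′) [ e ]) (trans (sym (++-assoc P [ c ] (z′ ∷ʳ e))) eq))
    , pal-P , k≤P , tc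

zeros-then-nonzero : ∀ {n} (v : List (Fin (suc n))) {r} → nonzero ⊨ head r →
  ∃₂ λ P z → P ++ z ≡ v × All (_≡ zero) P × nonzero ⊨ head (z ++ r)
zeros-then-nonzero []            tr = [] , [] , refl , [] , tr
zeros-then-nonzero (zero ∷ v)    tr with zeros-then-nonzero v tr
... | P , z , eq , zs , tz = zero ∷ P , z , cong (zero ∷_) eq , refl ∷ zs , tz
zeros-then-nonzero (suc c ∷ v)   tr = [] , suc c ∷ v , refl , [] , refl

constant-∷ʳ : ∀ {A : Set} {a : A} {P} → All (_≡ a) P → P ∷ʳ a ≡ a ∷ P
constant-∷ʳ []          = refl
constant-∷ʳ (refl ∷ as) = cong (_ ∷_) (constant-∷ʳ as)

constant-palindrome : ∀ {A : Set} {a : A} {P} → All (_≡ a) P → IsPalindrome P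
constant-palindrome []          = refl
constant-palindrome {P = a ∷ P} (refl ∷ as) =
  trans (unfold-reverse a P) (trans (cong (_∷ʳ a) (constant-palindrome as)) (constant-∷ʳ as))

palindromicPrefix-resp : ∀ {n} {t t′ : Context n} → t′ ≗ t → ∀ {k v r} →
                         PalindromicPrefix t k v r → PalindromicPrefix t′ k v r
palindromicPrefix-resp t′≗t (P , z , eq , pal , k≤P , tz) = P , z , eq , pal , k≤P , trans (t′≗t _) tz

module _ (t : Context 3) {x : List (Fin 3)} where

  good-returns : Good t → Invariant x → Returns t x
  good-returns (inj₁ total) (ret , _) p y py v r vr tp tr u w uw pal w≢[] _ w′ uw′ _
    with ret p y py v r vr refl refl u w uw pal w≢[] refl w′ uw′ refl
  ... | P , z , eq , pal-P , u<P , _ = P , z , eq , pal-P , u<P , total-head-++ t total z tr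
  good-returns (inj₂ (inj₁ (c , single))) (ret , _) p y py v r vr tp tr u w uw pal w≢[] tw w′ uw′ tw′ 
    with initLast p | r
  ... | [] | _ = contradiction (single _ tp) λ ()
  ... | p′ ∷ʳ′ d | [] = contradiction (single _ tr) λ ()
  ... | p′ ∷ʳ′ d | e ∷ r′
    rewrite reverse-++ p′ [ d ]
    with single _ tp | single _ tr
  ... | refl | refl = unwrap t tp (subst (λ k → PalindromicPrefix anywhere k (c ∷ v ∷ʳ c) r′) len
      (ret p′ (c ∷ y) (trans (sym (++-assoc p′ [ c ] y)) py) (c ∷ v ∷ʳ c) r′
        (cong (c ∷_) (trans (++-assoc v [ c ] r′) vr)) refl refl
        (c ∷ u ∷ʳ c) (proj₁ (after w tw w≢[])) wrapped (trans (reverse-wrap c c u) (cong (λ u → c ∷ u ∷ʳ c) pal))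
        (proj₁ (proj₂ (after w tw w≢[]))) refl
        (proj₁ (after w′ tw′ w′≢[])) wrapped′ refl))
    where
    -- With `w′` empty, `reverse v` would be the palindrome `u`, hence `v` would be `u` and `w`
    -- empty.
    w′≢[] : w′ ≢ []
    w′≢[] refl = w≢[] (++-identityʳ-unique u
      (trans (sym (trans (sym (reverse-involutive v)) (trans (cong reverse (sym uw′)) (trans (reverse-++ u []) pal)))) (sym uw)))
    after : ∀ {s} w → t ⊨ head (w ++ s) → w ≢ [] → ∃ λ w₁ → w₁ ≢ [] × [ c ] ++ w₁ ≡ w ∷ʳ c
    after []       _  w≢[] = contradiction refl w≢[]
    after (a ∷ w₁) tw _ with single (just a) tw
    ... | refl = w₁ ∷ʳ c , (λ e → contradiction (++-conicalʳ w₁ [ c ] e) λ ()) , refl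
    wrapped : (c ∷ u ∷ʳ c) ++ proj₁ (after w tw w≢[]) ≡ c ∷ v ∷ʳ c
    wrapped = cong (c ∷_) (trans (++-assoc u [ c ] _) (trans (cong (u ++_) (proj₂ (proj₂ (after w tw w≢[]))))
      (trans (sym (++-assoc u w [ c ])) (cong (_∷ʳ c) uw))))
    wrapped′ : (c ∷ u ∷ʳ c) ++ proj₁ (after w′ tw′ w′≢[]) ≡ reverse (c ∷ v ∷ʳ c)
    wrapped′ = trans (cong (c ∷_) (trans (++-assoc u [ c ] _) (trans (cong (u ++_) (proj₂ (proj₂ (after w′ tw′ w′≢[]))))
      (trans (sym (++-assoc u w′ [ c ])) (cong (_∷ʳ c) uw′))))) (sym (reverse-wrap c c v))
    len : suc (length (c ∷ u ∷ʳ c)) ≡ suc (suc (suc (length u)))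
    len = cong (2 +_) (trans (length-++ u {[ c ]}) (+-comm (length u) 1))
  good-returns (inj₂ (inj₂ t≗)) (_ , ret) p y py v r vr tp tr u w uw pal w≢[] tw w′ uw′ tw′ =
    palindromicPrefix-resp t≗ (ret p y py v r vr (to tp) (to tr) u w uw pal w≢[] (to tw) w′ uw′ (to tw′))
    where
    to : ∀ {m} → t ⊨ m → nonzero ⊨ m
    to = trans (sym (t≗ _))

  -- The prefix is empty for a total context. For a single letter `c` it comes from the return of
  -- the border `[ c ]` of `c ∷ v ∷ʳ c`, and for `nonzero` it is the initial run of zeros of `v`.
  good-starts : Good t → Invariant x → Starts t x
  good-starts (inj₁ total) _ p y py v r vr tp tr = [] , v , refl , refl , z≤n , total-head-++ t total v tr
  good-starts (inj₂ (inj₁ (c , single))) (ret , _) p y py v r vr tp tr with initLast p | r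
  ... | [] | _ = contradiction (single _ tp) λ ()
  ... | p′ ∷ʳ′ d | [] = contradiction (single _ tr) λ ()
  ... | p′ ∷ʳ′ d | e ∷ r′
    rewrite reverse-++ p′ [ d ]
    with single _ tp | single _ tr
  ... | refl | refl = unwrap t tp
      (ret p′ (c ∷ y) (trans (sym (++-assoc p′ [ c ] y)) py) (c ∷ v ∷ʳ c) r′
        (cong (c ∷_) (trans (++-assoc v [ c ] r′) vr)) refl refl
        [ c ] (v ∷ʳ c) refl refl (λ e → contradiction (++-conicalʳ v [ c ] e) λ ()) refl
        (reverse v ∷ʳ c) (sym (reverse-wrap c c v)) refl)
  good-starts (inj₂ (inj₂ t≗)) _ p y py v r vr tp tr with zeros-then-nonzero v (trans (sym (t≗ _)) tr)
  ... | P , z , eq , zs , tz = P , z , eq , constant-palindrome zs , z≤n , trans (t≗ _) tz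

-- Words without zeros

module _ {n : ℕ} where

  ZeroFree : List (Fin (suc n)) → Set
  ZeroFree = All (_≢ zero)

  zeroFree-reverse : ∀ {s} → ZeroFree s → ZeroFree (reverse s)
  zeroFree-reverse {[]}    []        = []
  zeroFree-reverse {a ∷ s} (a≢ ∷ zf) =
    subst ZeroFree (sym (unfold-reverse a s)) (All.++⁺ (zeroFree-reverse zf) (a≢ ∷ []))

  zero-∉ : ∀ {s} A {B} → ZeroFree s → s ≢ A ++ zero ∷ B
  zero-∉ []      (z≢ ∷ _)  refl = z≢ refl
  zero-∉ (_ ∷ A) (_ ∷ zf)  refl = zero-∉ A zf refl

  skip-zeroFree : ∀ {s X} A {B} → ZeroFree s → s ++ X ≡ A ++ zero ∷ B →
                  ∃ λ A′ → A ≡ s ++ A′ × X ≡ A′ ++ zero ∷ B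
  skip-zeroFree A       []        eq = A , refl , eq
  skip-zeroFree []      (a≢ ∷ zf) eq = contradiction (∷-injectiveˡ eq) a≢
  skip-zeroFree (b ∷ A) (a≢ ∷ zf) eq with ∷-injective eq
  ... | refl , eq′ with skip-zeroFree A zf eq′
  ...   | A′ , refl , X≡ = A′ , refl , X≡

  first-zero-unique : ∀ {s s′ X X′} → ZeroFree s → ZeroFree s′ → s ++ zero ∷ X ≡ s′ ++ zero ∷ X′ → s ≡ s′ × X ≡ X′
  first-zero-unique []        []        refl = refl , refl
  first-zero-unique []        (a≢ ∷ _)  eq   = contradiction (sym (∷-injectiveˡ eq)) a≢
  first-zero-unique (a≢ ∷ _)  []        eq   = contradiction (∷-injectiveˡ eq) a≢
  first-zero-unique (_ ∷ zf)  (_ ∷ zf′) eq with ∷-injective eq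
  ... | refl , eq′ with first-zero-unique zf zf′ eq′
  ...   | refl , refl = refl , refl

  first-zero : ∀ y → ZeroFree y ⊎ ∃₂ λ s m → ZeroFree s × y ≡ s ++ zero ∷ m
  first-zero []          = inj₁ []
  first-zero (zero ∷ y)  = inj₂ ([] , y , [] , refl)
  first-zero (suc a ∷ y) with first-zero y
  ... | inj₁ zf                = inj₁ ((λ ()) ∷ zf)
  ... | inj₂ (s , m , zf , eq) = inj₂ (suc a ∷ s , m , (λ ()) ∷ zf , cong (suc a ∷_) eq)

  last-zero : ∀ y → ZeroFree y ⊎ ∃₂ λ m e → ZeroFree e × y ≡ m ++ zero ∷ e
  last-zero []      = inj₁ []
  last-zero (a ∷ y) with last-zero y
  last-zero (a     ∷ y) | inj₂ (m , e , zf , eq) = inj₂ (a ∷ m , e , zf , cong (a ∷_) eq)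
  last-zero (zero  ∷ y) | inj₁ zf = inj₂ ([] , y , zf , refl)
  last-zero (suc a ∷ y) | inj₁ zf = inj₁ ((λ ()) ∷ zf)

module _ {A : Set} where

  head-++ˡ : ∀ x {y : List A} → x ≢ [] → head (x ++ y) ≡ head x
  head-++ˡ []      x≢[] = contradiction refl x≢[]
  head-++ˡ (_ ∷ _) _    = refl

  head-++-cong : ∀ z {x y : List A} → head x ≡ head y → head (z ++ x) ≡ head (z ++ y)
  head-++-cong []      eq = eq
  head-++-cong (_ ∷ _) eq = refl

  reverse-≢[] : ∀ {x : List A} → x ≢ [] → reverse x ≢ []
  reverse-≢[] x≢[] eq = x≢[] (reverse-injective eq)

does-sound : ∀ {A : Set} (a? : Dec A) → does a? ≡ true → A
does-sound (yes a) _ = a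

-- Marked morphisms and their unique decoding

module Marked {n : ℕ} (q : Fin 3 → List (Fin (suc n)))
              (q-zeroFree : ∀ a → ZeroFree (q a))
              (q-palindrome : ∀ a → IsPalindrome (q a))
              (q-injective : ∀ a b → q a ≡ q b → a ≡ b) where

  -- Φ x = φ(x) 0: the closing marker makes Φ commute with reversal.  Ψ drops the opening one instead.
  Ψ Φ : List (Fin 3) → List (Fin (suc n))
  Ψ = concatMap (λ a → q a ∷ʳ zero)
  Φ x = zero ∷ Ψ x

  Ψ-++ : ∀ x y → Ψ (x ++ y) ≡ Ψ x ++ Ψ y
  Ψ-++ = concatMap-++ _

  Ψ-∷ : ∀ a x → Ψ (a ∷ x) ≡ q a ++ Φ x
  Ψ-∷ a x = ++-assoc (q a) [ zero ] (Ψ x)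

  reverse-Φ : ∀ x → reverse (Φ x) ≡ Φ (reverse x)
  reverse-Φ []      = refl
  reverse-Φ (a ∷ x) = begin
    reverse (zero ∷ Ψ (a ∷ x))                  ≡⟨ cong (reverse ∘ (zero ∷_)) (Ψ-∷ a x) ⟩
    reverse ((zero ∷ q a) ++ Φ x)               ≡⟨ reverse-++ (zero ∷ q a) (Φ x) ⟩
    reverse (Φ x) ++ reverse (zero ∷ q a)       ≡⟨ cong₂ _++_ (reverse-Φ x) (unfold-reverse zero (q a)) ⟩
    Φ (reverse x) ++ (reverse (q a) ∷ʳ zero)    ≡⟨ cong (λ b → Φ (reverse x) ++ (b ∷ʳ zero)) (q-palindrome a) ⟩
    Φ (reverse x) ++ (q a ∷ʳ zero)              ≡⟨ cong (Φ (reverse x) ++_) (sym (++-identityʳ _)) ⟩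
    Φ (reverse x) ++ Ψ [ a ]                    ≡⟨ cong (zero ∷_) (sym (Ψ-++ (reverse x) [ a ])) ⟩
    Φ (reverse x ∷ʳ a)                          ≡⟨ cong Φ (sym (unfold-reverse a x)) ⟩
    Φ (reverse (a ∷ x))                         ∎
    where open ≡-Reasoning

  reverse-marked : ∀ s v e → reverse (reverse s ++ Φ v ++ e) ≡ reverse e ++ Φ (reverse v) ++ s
  reverse-marked s v e = begin
    reverse (reverse s ++ Φ v ++ e)                  ≡⟨ reverse-++ (reverse s) (Φ v ++ e) ⟩
    reverse (Φ v ++ e) ++ reverse (reverse s)        ≡⟨ cong₂ _++_ (reverse-++ (Φ v) e) (reverse-involutive s) ⟩
    (reverse e ++ reverse (Φ v)) ++ s                ≡⟨ ++-assoc (reverse e) _ s ⟩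
    reverse e ++ reverse (Φ v) ++ s                  ≡⟨ cong (λ φ → reverse e ++ φ ++ s) (reverse-Φ v) ⟩
    reverse e ++ Φ (reverse v) ++ s                  ∎
    where open ≡-Reasoning

  -- Blocks and `e` are free of zeros, so every zero is a marker, and cutting after it cuts `v`
  -- between two letters.
  split-at-zero : ∀ v {e} A {B} → ZeroFree e → Φ v ++ e ≡ A ++ zero ∷ B →
                  ∃₂ λ v₁ v₂ → v₁ ++ v₂ ≡ v × A ∷ʳ zero ≡ Φ v₁ × Ψ v₂ ++ e ≡ B
  split-at-zero v       []      zf eq = [] , v , refl , refl , ∷-injectiveʳ eq
  split-at-zero []      (b ∷ A) zf eq = contradiction (∷-injectiveʳ eq) (zero-∉ A zf)
  split-at-zero (a ∷ v) {e} (b ∷ A) zf eq with ∷-injective eq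
  ... | refl , eq′ with skip-zeroFree A (q-zeroFree a)
                          (trans (sym (++-assoc (q a) (Φ v) e)) (trans (cong (_++ e) (sym (Ψ-∷ a v))) eq′))
  ...   | A′ , refl , eq″ with split-at-zero v A′ zf eq″
  ...     | v₁ , v₂ , refl , A≡ , B≡ = a ∷ v₁ , v₂ , refl
            , cong (zero ∷_) (trans (++-assoc (q a) A′ [ zero ]) (trans (cong (q a ++_) A≡) (sym (Ψ-∷ a v₁)))) , B≡

  -- The first zero delimits the first block, and injectivity of `q` recovers its letter.
  Ψ-unique : ∀ v v′ {e e′} → ZeroFree e → ZeroFree e′ → Ψ v ++ e ≡ Ψ v′ ++ e′ → v ≡ v′ × e ≡ e′
  Ψ-unique []      []       zf zf′ eq = refl , eq
  Ψ-unique []      (b ∷ v′) {e} {e′} zf zf′ eq = contradiction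
    (trans eq (trans (cong (_++ e′) (Ψ-∷ b v′)) (++-assoc (q b) (Φ v′) e′))) (zero-∉ (q b) zf)
  Ψ-unique (a ∷ v) []       {e} {e′} zf zf′ eq = contradiction
    (trans (sym eq) (trans (cong (_++ e) (Ψ-∷ a v)) (++-assoc (q a) (Φ v) e))) (zero-∉ (q a) zf′)
  Ψ-unique (a ∷ v) (b ∷ v′) {e} {e′} zf zf′ eq
    with first-zero-unique (q-zeroFree a) (q-zeroFree b)
           (trans (sym (trans (cong (_++ e) (Ψ-∷ a v)) (++-assoc (q a) (Φ v) e)))
             (trans eq (trans (cong (_++ e′) (Ψ-∷ b v′)) (++-assoc (q b) (Φ v′) e′))))
  ... | qa≡qb , eq′ with q-injective a b qa≡qb | Ψ-unique v v′ zf zf′ eq′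
  ...   | refl | refl , e≡ = refl , e≡

  marked-unique : ∀ {s s′} v v′ {e e′} → ZeroFree s → ZeroFree s′ → ZeroFree e → ZeroFree e′ →
                  s ++ Φ v ++ e ≡ s′ ++ Φ v′ ++ e′ → s ≡ s′ × v ≡ v′ × e ≡ e′
  marked-unique v v′ zs zs′ ze ze′ eq with first-zero-unique zs zs′ eq
  ... | refl , eq′ = refl , Ψ-unique v v′ ze ze′ eq′

  -- A factor with a zero consists of whole blocks between markers, with partial blocks at both
  -- ends. The left side is stored reversed, so that both sides satisfy the same kind of equation
  -- and the context lemmas apply to either.
  record Parse (p y r : List (Fin (suc n))) (x′ : List (Fin 3)) : Set where
    field
      {left core right} : List (Fin 3)
      {before after}    : List (Fin (suc n))
      x′≡      : reverse left ++ core ++ right ≡ x′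
      y≡       : y ≡ reverse before ++ Φ core ++ after
      before-zf : ZeroFree before
      after-zf  : ZeroFree after
      left≡    : before ++ reverse p ≡ Ψ left
      right≡   : after ++ r ≡ Ψ right

  parse : ∀ x p y r → p ++ y ++ r ≡ Φ x → ZeroFree y ⊎ Parse p y r x
  parse x p y r eq with first-zero y
  ... | inj₁ zf = inj₁ zf
  ... | inj₂ (s , m , zs , refl)
    with split-at-zero x (p ++ s) [] (trans (++-identityʳ (Φ x)) (trans (sym eq)
           (trans (cong (p ++_) (++-assoc s (zero ∷ m) r)) (sym (++-assoc p s _)))))
  ...   | x₁ , x₂ , refl , x₁≡ , x₂≡ with last-zero (zero ∷ m)
  ...     | inj₁ (z≢ ∷ _) = contradiction refl z≢
  ...     | inj₂ (m′ , e , ze , m≡)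
    with split-at-zero x₂ m′ {e ++ r} [] (trans (++-identityʳ (Φ x₂))
           (trans (cong (zero ∷_) (trans (sym (++-identityʳ (Ψ x₂))) x₂≡))
             (trans (cong (_++ r) m≡) (++-assoc m′ (zero ∷ e) r))))
  ...       | v , x₃ , refl , v≡ , x₃≡ = inj₂ record
    { left      = reverse x₁
    ; core      = v
    ; right     = x₃
    ; x′≡       = cong (_++ (v ++ x₃)) (reverse-involutive x₁)
    ; y≡        = trans (cong (s ++_) (trans m≡ (trans (sym (++-assoc m′ [ zero ] e)) (cong (_++ e) v≡))))
                        (cong (_++ (Φ v ++ e)) (sym (reverse-involutive s)))
    ; before-zf = zeroFree-reverse zs
    ; after-zf  = ze
    ; left≡     = ∷-injectiveʳ (trans (sym (trans (reverse-++ (p ++ s) [ zero ]) (cong (zero ∷_) (reverse-++ p s))))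
                    (trans (cong reverse x₁≡) (reverse-Φ x₁)))
    ; right≡    = trans (sym x₃≡) (++-identityʳ (Ψ x₃))
    }

  prefix-zeroFree : ∀ {u w} s v e → ZeroFree u → u ++ w ≡ reverse s ++ Φ v ++ e →
                    ∃ λ z → u ++ z ≡ reverse s × z ++ Φ v ++ e ≡ w
  prefix-zeroFree s v e zu eq with skip-zeroFree (reverse s) zu eq
  ... | z , s≡ , w≡ = z , sym s≡ , sym w≡

  prefix-marked : ∀ {u w} s v e m {k} → u ≡ m ++ zero ∷ k → ZeroFree s → ZeroFree e → ZeroFree k →
                  u ++ w ≡ reverse s ++ Φ v ++ e →
                  ∃₂ λ v₁ v₂ → v₁ ++ v₂ ≡ v × u ≡ reverse s ++ Φ v₁ ++ k × Ψ v₂ ++ e ≡ k ++ w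
  prefix-marked {w = w} s v e m {k} refl zs ze zk eq
    with skip-zeroFree m (zeroFree-reverse zs) (trans (sym eq) (++-assoc m (zero ∷ k) w))
  ... | m′ , refl , eq′ with split-at-zero v m′ ze eq′
  ...   | v₁ , v₂ , v≡ , m≡ , e≡ = v₁ , v₂ , v≡
          , trans (++-assoc (reverse s) m′ (zero ∷ k)) (cong (reverse s ++_)
              (trans (sym (++-assoc m′ [ zero ] k)) (cong (_++ k) m≡))) , e≡

  -- Pulling contexts back through the morphism

  -- `block m ++ mark m` is the text next to `Φ core` on the side of the neighbour `m`. At the
  -- boundary it is empty, because the outermost marker already belongs to `Φ core`.
  block : Maybe (Fin 3) → List (Fin (suc n))
  block nothing  = []
  block (just a) = q a

  mark : Maybe (Fin 3) → List (Fin (suc n))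
  mark nothing  = []
  mark (just _) = [ zero ]

  -- The neighbours `m` of a core whose block lets it be extended by `s` and then followed by a
  -- letter in `t`. Quantifying over the splits of the block brings this under `∃split?`.
  Pull : Context (suc n) → List (Fin (suc n)) → Maybe (Fin 3) → Set
  Pull t s m = ∃₂ λ s′ B → s′ ++ B ≡ block m × s′ ≡ s × t ⊨ head (B ++ mark m)

  pull? : ∀ t s m → Dec (Pull t s m)
  pull? t s m = ∃split? (λ s′ B → s′ ≟ₗ s ×-dec t ⊨? head (B ++ mark m)) (block m)

  pull : Context (suc n) → List (Fin (suc n)) → Context 3
  pull t s m = does (pull? t s m)

  context-after : ∀ {s} r {R} → ZeroFree s → s ++ R ≡ Ψ r →
                  ∃ λ B → s ++ B ≡ block (head r) × head R ≡ head (B ++ mark (head r))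
  context-after {s} [] {R} zs eq = [] , trans (++-identityʳ s) (++-conicalˡ s R eq) , cong head (++-conicalʳ s R eq)
  context-after {s} (a ∷ r) zs eq with skip-zeroFree (q a) zs (trans eq (Ψ-∷ a r))
  ... | B , q≡ , refl = B , sym q≡ , head-++-cong B refl

  pull-complete : ∀ {t s} r {R} → ZeroFree s → s ++ R ≡ Ψ r → t ⊨ head R → pull t s ⊨ head r
  pull-complete {t} {s} r zs eq tR with context-after r zs eq
  ... | B , s≡ , R≡ = dec-true (pull? t s (head r)) (s , B , s≡ , refl , subst (t ⊨_) R≡ tR)

  -- The borders u of  reverse s · Φ v · e  that contain no marker: either reverse s alone already has a
  -- longer palindromic prefix, or the mirror image of s recurs at the end and one reaches it through Φ.
  Local : Context (suc n) → Set
  Local t = ∀ m s A → s ++ A ≡ block m → t ⊨ head (A ++ mark m) →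
            ∀ m′ e B → e ++ B ≡ block m′ → t ⊨ head (B ++ mark m′) →
            ∀ u z → u ++ z ≡ reverse s → IsPalindrome u → t ⊨ head (z ∷ʳ zero) →
            ∀ z′ → u ++ z′ ≡ reverse e → t ⊨ head (z′ ∷ʳ zero) →
            PalindromicPrefix t (suc (length u)) (reverse s) [ zero ]
              ⊎ (∃₂ λ s′ e′ → s′ ++ e′ ≡ e × s′ ≡ s × t ⊨ head (e′ ++ B ++ mark m′))

  local? : ∀ t → Dec (Local t)
  local? t = ∀maybe? λ m → ∀split? (λ s A → t ⊨? head (A ++ mark m) →-dec
    ∀maybe? λ m′ → ∀split? (λ e B → t ⊨? head (B ++ mark m′) →-dec
      ∀split? (λ u z → reverse u ≟ₗ u →-dec t ⊨? head (z ∷ʳ zero) →-dec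
        ∀suffix? (λ z′ → t ⊨? head (z′ ∷ʳ zero) →-dec
          (palindromicPrefix? t (suc (length u)) (reverse s) [ zero ]
            ⊎-dec ∃split? (λ s′ e′ → s′ ≟ₗ s ×-dec t ⊨? head (e′ ++ B ++ mark m′)) e))
          u (reverse e)) (reverse s)) (block m′)) (block m)

  -- The finite conditions on `q` behind the three cases of `Φ-returns`: cores have good contexts,
  -- returns hold inside one block, and borders without a marker are handled by `Local`.
  Admissible : Context (suc n) → Set
  Admissible t = (∀ m s A → s ++ A ≡ block m → Good (pull t s)) × (∀ a → Returns t (Φ [ a ])) × Local t

  admissible? : ∀ t → Dec (Admissible t)
  admissible? t = ∀maybe? (λ m → ∀split? (λ s A → good? (pull t s)) (block m))
    ×-dec Fin.all? (λ a → returns? t (Φ [ a ])) ×-dec local? t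

  -- Transfer of returns to the image

  -- A factor without a zero lies within one block, and its flanking letters are found in `Φ [ a ]`
  -- already.
  inside-block : ∀ x p {y r} → ZeroFree y → y ≢ [] → p ++ y ++ r ≡ Φ x →
                 ∃ λ a → ∃₂ λ p₀ p₁ → ∃ λ r₁ → p ≡ p₀ ++ zero ∷ p₁ × (zero ∷ p₁) ++ y ++ r₁ ≡ Φ [ a ] × head r ≡ head r₁
  inside-block x       []      []       y≢[] eq = contradiction refl y≢[]
  inside-block x       []      (a≢ ∷ _) y≢[] eq = contradiction (∷-injectiveˡ eq) a≢
  inside-block []      (b ∷ p) {y} {r} zy y≢[] eq =
    contradiction (++-conicalˡ y r (++-conicalʳ p (y ++ r) (∷-injectiveʳ eq))) y≢[]
  inside-block (a ∷ x) (b ∷ p) {y} {r} zy y≢[] eq with ∷-injective eq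
  ... | refl , eq′ with ++-compare p (y ++ r) (q a) (Φ x) (trans eq′ (Ψ-∷ a x))
  ...   | inj₂ (k , refl , eq″) with inside-block x k zy y≢[] (sym eq″)
  ...     | a′ , p₀ , p₁ , r₁ , refl , eq₁ , r≡ =
            a′ , zero ∷ q a ++ p₀ , p₁ , r₁ , cong (zero ∷_) (sym (++-assoc (q a) p₀ (zero ∷ p₁))) , eq₁ , r≡
  inside-block (a ∷ x) (b ∷ p) {y} {r} zy y≢[] eq | refl , eq′
        | inj₁ (c , k , q≡ , yr≡) with skip-zeroFree (c ∷ k) zy yr≡
  ...     | k′ , ck≡ , refl = a , [] , p , k′ ∷ʳ zero , refl
          , cong (zero ∷_) (trans (cong (p ++_) (sym (++-assoc y k′ [ zero ])))
              (trans (cong (λ z → p ++ z ++ [ zero ]) (sym ck≡))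
                (trans (sym (++-assoc p (c ∷ k) [ zero ])) (trans (cong (_∷ʳ zero) (sym q≡)) (sym (++-identityʳ _))))))
          , head-++-cong k′ refl

  -- A palindromic prefix `P` of the core lifts to `reverse s ++ Φ P ++ s`. The last `s` is read at
  -- the end of `y` if `P` is the whole core, and otherwise from the next block, which starts with
  -- `s` by the choice of `pull t s`.
  finish : ∀ {t s e v r y R j k} → ZeroFree s → y ≡ reverse s ++ Φ v ++ s ++ e → (s ++ e) ++ R ≡ Ψ r → t ⊨ head (e ++ R) →
           (∀ P z → P ++ z ≡ v → k ≤ length P → j ≤ length (reverse s ++ Φ P ++ s)) →
           PalindromicPrefix (pull t s) k v r → PalindromicPrefix t j y R
  finish {t} {s} {e} {v} {r} {R = R} zs refl r≡ te bound (P , z , refl , pal , k≤P , tz) =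
    (reverse s ++ Φ P ++ s) , proj₁ (rest z tz)
    , trans (++-assoc (reverse s) (Φ P ++ s) _) (cong (reverse s ++_) (trans (++-assoc (Φ P) s _)
        (trans (cong (Φ P ++_) (proj₁ (proj₂ (rest z tz))))
          (trans (sym (++-assoc (Φ P) (Ψ z) (s ++ e))) (cong (λ φ → zero ∷ φ ++ s ++ e) (sym (Ψ-++ P z)))))))
    , trans (reverse-marked s P s) (cong (λ P → reverse s ++ Φ P ++ s) pal)
    , bound P z refl k≤P , proj₂ (proj₂ (rest z tz))
    where
    rest : ∀ z → pull t s ⊨ head (z ++ r) → ∃ λ z₀ → s ++ z₀ ≡ Ψ z ++ s ++ e × t ⊨ head (z₀ ++ R)
    rest []      tz = e , refl , te
    rest (a ∷ z) tz with does-sound (pull? t s (just a)) tz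
    ... | .s , B , s≡ , refl , tB = B ++ Φ z ++ s ++ e
      , trans (sym (++-assoc s B _)) (trans (cong (_++ (Φ z ++ s ++ e)) s≡)
          (trans (sym (++-assoc (q a) (Φ z) (s ++ e))) (cong (_++ (s ++ e)) (sym (Ψ-∷ a z)))))
      , subst (t ⊨_) (trans (head-++-cong B refl) (cong head (sym (++-assoc B (Φ z ++ s ++ e) R)))) tB

  length-++-mono-< : ∀ (u : List (Fin (suc n))) {v w} → length v < length w → length (u ++ v) < length (u ++ w)
  length-++-mono-< []      v<w = v<w
  length-++-mono-< (_ ∷ u) v<w = s≤s (length-++-mono-< u v<w)

  length-<-++ : ∀ (u : List (Fin (suc n))) {v} → u ≢ [] → length v < length (u ++ v)
  length-<-++ []      u≢[] = contradiction refl u≢[]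
  length-<-++ (_ ∷ u) {v} _ = s≤s (≤-trans (m≤n+m (length v) (length u)) (≤-reflexive (sym (length-++ u))))

  marked-length-< : ∀ s {v w P z} → v ++ w ≡ P ++ z → length v < length P →
                    length (reverse s ++ Φ v ++ s) < length (reverse s ++ Φ P ++ s)
  marked-length-< s {v} {w} {P} {z} eq v<P with longer-prefix v w P z eq v<P
  ... | c , k , refl , _ = length-++-mono-< (reverse s)
    (subst (λ y → length (Φ v ++ s) < length y) (sym Φ≡) (length-++-mono-< (Φ v) (length-<-++ (Ψ (c ∷ k))
      λ e → contradiction (++-conicalʳ (q c) (Φ k) (trans (sym (Ψ-∷ c k)) e)) λ ())))
    where
    Φ≡ : Φ (v ++ c ∷ k) ++ s ≡ Φ v ++ Ψ (c ∷ k) ++ s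
    Φ≡ = trans (cong (λ φ → zero ∷ φ ++ s) (Ψ-++ v (c ∷ k))) (++-assoc (Φ v) (Ψ (c ∷ k)) s)

  Φ-returns : ∀ t {x} → Admissible t → Invariant x → Returns t (Φ x)
  Φ-returns t {x} (good , blocks , local) inv p _ pyr≡ y r refl tp tr u w uw≡ pal w≢[] tw w′ w′≡ tw′
    with parse x p y r pyr≡
  -- No marker in `y`: everything happens inside one block.
  ... | inj₁ zf
    with inside-block x p zf (λ e → w≢[] (++-conicalʳ u w (trans uw≡ e))) pyr≡
  ...   | a , p₀ , p₁ , r₁ , refl , eq , r≡
    with blocks a (zero ∷ p₁) (y ++ r₁) eq y r₁ refl
           (subst (t ⊨_) p≡ tp) (subst (t ⊨_) r≡ tr) u w uw≡ pal w≢[] (subst (t ⊨_) (head-++-cong w r≡) tw)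
           w′ w′≡ (subst (t ⊨_) (head-++-cong w′ p≡) tw′)
    where
    p≡ : head (reverse (p₀ ++ zero ∷ p₁)) ≡ head (reverse (zero ∷ p₁))
    p≡ = trans (cong head (reverse-++ p₀ (zero ∷ p₁))) (head-++ˡ (reverse (zero ∷ p₁)) (reverse-≢[] {x = zero ∷ p₁} λ ()))
  ...     | P , z , Pz , pal-P , u<P , tz = P , z , Pz , pal-P , u<P , subst (t ⊨_) (head-++-cong z (sym r≡)) tz
  Φ-returns t {x} (good , blocks , local) inv p _ pyr≡ y r refl tp tr u w uw≡ pal w≢[] tw w′ w′≡ tw′
      | inj₂ record { left = l ; core = v ; right = x₃ ; before = s ; after = e
                    ; x′≡ = refl ; y≡ = y≡ ; before-zf = zs ; after-zf = ze ; left≡ = l≡ ; right≡ = r≡ }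
    with context-after l zs l≡ | context-after x₃ ze r≡ | last-zero u
  -- Markers in `y` but none in `u`: the border lies inside the partial blocks `reverse s` and, seen
  -- from the other end, `reverse e`.
  ... | A , sA , A≡ | B , eB , B≡ | inj₁ zu
    with prefix-zeroFree s v e zu (trans uw≡ y≡)
       | prefix-zeroFree e (reverse v) s zu (trans w′≡ (trans (cong reverse y≡) (reverse-marked s v e)))
  ...   | z , uz , refl | z′ , uz′ , refl
    with local (head l) s A sA (subst (t ⊨_) A≡ tp) (head x₃) e B eB (subst (t ⊨_) B≡ tr) u z uz pal
           (subst (t ⊨_) (trans (cong head (++-assoc z (Φ v ++ e) r)) (head-++-cong z refl)) tw) z′ uz′
           (subst (t ⊨_) (trans (cong head (++-assoc z′ (Φ (reverse v) ++ s) (reverse p))) (head-++-cong z′ refl)) tw′)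
  ...     | inj₁ (P , z₀ , Pz₀ , pal-P , u<P , tz₀) = P , z₀ ++ Φ v ++ e
    , trans (sym (++-assoc P z₀ _)) (trans (cong (_++ (Φ v ++ e)) Pz₀) (sym y≡)) , pal-P , u<P
    , subst (t ⊨_) (sym (trans (cong head (++-assoc z₀ (Φ v ++ e) r)) (head-++-cong z₀ refl))) tz₀
  ...     | inj₂ (.s , e′ , refl , refl , te′) = finish {t} zs y≡ r≡
    (subst (t ⊨_) (sym (head-++-cong e′ B≡)) te′)
    -- Even for empty `P` the marker in `Φ P` makes the new palindrome longer than `u`, a prefix of
    -- `reverse s`.
    (λ P _ _ _ → ≤-trans (s≤s (≤-trans (m≤m+n (length u) (length z))
        (≤-reflexive (trans (sym (length-++ u)) (cong length uz)))))
      (≤-trans (≤-reflexive (+-comm 1 _)) (≤-trans (+-monoʳ-≤ (length (reverse s)) (s≤s z≤n))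
        (≤-reflexive (sym (length-++ (reverse s)))))))
    (good-starts (pull t s) (good (head l) s A sA) inv (reverse l) (v ++ x₃) refl v x₃ refl
      (subst (λ l → pull t s ⊨ head l) (sym (reverse-involutive l)) (pull-complete {t} l zs l≡ tp))
      (pull-complete {t} x₃ zs (trans (sym (++-assoc s e′ r)) r≡) (subst (t ⊨_) (sym (head-++-cong e′ B≡)) te′)))
  Φ-returns t {x} (good , blocks , local) inv p _ pyr≡ y r refl tp tr u w uw≡ pal w≢[] tw w′ w′≡ tw′
      | inj₂ record { left = l ; core = v ; right = x₃ ; before = s ; after = e
                    ; x′≡ = refl ; y≡ = y≡ ; before-zf = zs ; after-zf = ze ; left≡ = l≡ ; right≡ = r≡ }
      | A , sA , A≡ | B , eB , B≡ | inj₂ (m , k , zk , u≡)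
    with prefix-marked s v e m u≡ zs ze zk (trans uw≡ y≡)
       | prefix-marked e (reverse v) s m u≡ ze zs zk (trans w′≡ (trans (cong reverse y≡) (reverse-marked s v e)))
  ...   | v₁ , v₂ , refl , u≡₁ , w≡ | v₃ , v₄ , v≡ , u≡₂ , w′≡₂
    -- A marker in `u`: since `u` is a palindrome and a prefix of both `y` and `reverse y`, unique
    -- decoding forces `k`, `s` and `e` to agree and makes `v₁` a palindromic border of the core.
    with marked-unique (reverse v₁) v₁ (zeroFree-reverse zk) (zeroFree-reverse zs) zs zk
           (trans (sym (reverse-marked s v₁ k)) (trans (cong reverse (sym u≡₁)) (trans pal u≡₁)))
       | marked-unique v₁ v₃ (zeroFree-reverse zs) (zeroFree-reverse ze) zk zk (trans (sym u≡₁) u≡₂)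
  ...     | _ , pal-v₁ , refl | rs≡ , refl , _ with reverse-injective {x = s} {y = e} rs≡
  ...       | refl = finish {t} {e = []} zs (trans y≡ (cong (λ e → reverse s ++ Φ (v₁ ++ v₂) ++ e) (sym (++-identityʳ s))))
    (trans (cong (_++ r) (++-identityʳ s)) r≡) tr
    (λ P z Pz v₁<P → subst (λ y → length y < length (reverse s ++ Φ P ++ s)) (sym u≡₁)
      (marked-length-< s {v₁} {v₂} {P} {z} (sym Pz) v₁<P))
    (good-returns (pull t s) (good (head l) s A sA) inv (reverse l) ((v₁ ++ v₂) ++ x₃) refl (v₁ ++ v₂) x₃ refl
      (subst (λ l → pull t s ⊨ head l) (sym (reverse-involutive l)) (pull-complete {t} l zs l≡ tp))
      (pull-complete {t} x₃ zs r≡ tr)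
      v₁ v₂ refl pal-v₁
      (λ { refl → w≢[] (++-identityʳ-unique s w≡) })
      (pull-complete {t} (v₂ ++ x₃) zs (shift v₂ x₃ w≡ r≡) tw)
      v₄ v≡
      (subst (λ l → pull t s ⊨ head (v₄ ++ l)) (sym (reverse-involutive l))
        (pull-complete {t} (v₄ ++ l) zs (shift v₄ l w′≡₂ l≡) tw′)))
    where
    shift : ∀ v x {w R} → Ψ v ++ s ≡ s ++ w → s ++ R ≡ Ψ x → s ++ w ++ R ≡ Ψ (v ++ x)
    shift v x {w} {R} vs sR = trans (sym (++-assoc s w R)) (trans (cong (_++ R) (sym vs))
      (trans (++-assoc (Ψ v) s R) (trans (cong (Ψ v ++_) sR) (sym (Ψ-++ v x)))))

-- The three morphisms and their finite checks

qf : Fin 3 → List (Fin 2)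
qf zero             = []
qf (suc zero)       = 1₂ ∷ []
qf (suc (suc zero)) = 1₂ ∷ 1₂ ∷ []

qg qh : Fin 3 → List (Fin 3)
qg zero             = 1₃ ∷ 1₃ ∷ []
qg (suc zero)       = 1₃ ∷ 2₃ ∷ 1₃ ∷ []
qg (suc (suc zero)) = 1₃ ∷ 2₃ ∷ 1₃ ∷ 2₃ ∷ 1₃ ∷ []
qh zero             = 1₃ ∷ []
qh (suc zero)       = 2₃ ∷ []
qh (suc (suc zero)) = 2₃ ∷ 2₃ ∷ []

zeroFree? : ∀ {n} (q : Fin 3 → List (Fin (suc n))) → Dec (∀ a → ZeroFree (q a))
zeroFree? q = Fin.all? λ a → All.all? (λ b → ¬? (b Fin.≟ zero)) (q a)

palindromes? : ∀ {n} (q : Fin 3 → List (Fin n)) → Dec (∀ a → IsPalindrome (q a))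
palindromes? q = Fin.all? λ a → reverse (q a) ≟ₗ q a

injective? : ∀ {n} (q : Fin 3 → List (Fin n)) → Dec (∀ a b → q a ≡ q b → a ≡ b)
injective? q = Fin.all? λ a → Fin.all? λ b → q a ≟ₗ q b →-dec a Fin.≟ b

module F = Marked qf (from-yes (zeroFree? qf)) (from-yes (palindromes? qf)) (from-yes (injective? qf))
module G = Marked qg (from-yes (zeroFree? qg)) (from-yes (palindromes? qg)) (from-yes (injective? qg))
module H = Marked qh (from-yes (zeroFree? qh)) (from-yes (palindromes? qh)) (from-yes (injective? qh))

morph-∷ʳ : ∀ {n} {σ q : Fin 3 → List (Fin (suc n))} → (∀ a → σ a ≡ zero ∷ q a) →
           ∀ x → morph σ x ∷ʳ zero ≡ zero ∷ concatMap (λ a → q a ∷ʳ zero) x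
morph-∷ʳ σ≡ []      = refl
morph-∷ʳ {σ = σ} {q} σ≡ (a ∷ x) rewrite σ≡ a = cong (zero ∷_)
  (trans (++-assoc (q a) (morph σ x) [ zero ]) (trans (cong (q a ++_) (morph-∷ʳ σ≡ x))
    (sym (++-assoc (q a) [ zero ] _))))

fL≡ : ∀ a → fL a ≡ zero ∷ qf a
fL≡ zero             = refl
fL≡ (suc zero)       = refl
fL≡ (suc (suc zero)) = refl

gL≡ : ∀ a → gL a ≡ zero ∷ qg a
gL≡ zero             = refl
gL≡ (suc zero)       = refl
gL≡ (suc (suc zero)) = refl

hL≡ : ∀ a → hL a ≡ zero ∷ qh a
hL≡ zero             = refl
hL≡ (suc zero)       = refl
hL≡ (suc (suc zero)) = refl

-- For f the prefixes of blocks are the empty word, 1 and 11, with contexts all letters, {1,2} and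
-- {2}. As f is applied last, only `Returns anywhere` is wanted of its image, whereas h and g have
-- to carry both halves of `Invariant`.
F-admissible-anywhere : F.Admissible anywhere
F-admissible-anywhere = from-yes (F.admissible? anywhere)
H-admissible-anywhere : H.Admissible anywhere
H-admissible-anywhere = from-yes (H.admissible? anywhere)
H-admissible-nonzero : H.Admissible nonzero
H-admissible-nonzero = from-yes (H.admissible? nonzero)
G-admissible-anywhere : G.Admissible anywhere
G-admissible-anywhere = from-yes (G.admissible? anywhere)
G-admissible-nonzero : G.Admissible nonzero
G-admissible-nonzero = from-yes (G.admissible? nonzero)

-- The invariant along the iterates of h

-- The iterates of x ↦ h(x)0, a map that commutes with reversal, unlike h. They have the words
-- `hPow k` as prefixes.
stage : ℕ → List (Fin 3)
stage zero    = [ zero ]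
stage (suc k) = H.Φ (stage k)

stage-invariant : ∀ k → Invariant (stage k)
stage-invariant zero    = from-yes (returns? anywhere [ zero ]) , from-yes (returns? nonzero [ zero ])
stage-invariant (suc k) =
    H.Φ-returns anywhere H-admissible-anywhere (stage-invariant k)
  , H.Φ-returns nonzero H-admissible-nonzero (stage-invariant k)

-- Prefixes, growth and infinite limits

_⊑_ : {A : Set} → List A → List A → Set
u ⊑ w = ∃ λ e → u ++ e ≡ w

⊑-trans : {A : Set} {u v w : List A} → u ⊑ v → v ⊑ w → u ⊑ w
⊑-trans {u = u} (e , refl) (e′ , refl) = e ++ e′ , sym (++-assoc u e e′)

morph-⊑ : {A B : Set} (σ : A → List B) {u w : List A} → u ⊑ w → morph σ u ⊑ morph σ w
morph-⊑ σ {u} (e , refl) = morph σ e , sym (concatMap-++ σ u e)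

morph-⊑-Φ : ∀ {n} {σ q : Fin 3 → List (Fin (suc n))} → (∀ a → σ a ≡ zero ∷ q a) →
            ∀ {u x} → u ⊑ x → morph σ u ⊑ (zero ∷ concatMap (λ a → q a ∷ʳ zero) x)
morph-⊑-Φ {σ = σ} σ≡ {x = x} u⊑x = ⊑-trans (morph-⊑ σ u⊑x) ([ zero ] , morph-∷ʳ σ≡ x)

hPow-⊑-stage : ∀ k → hPow k ⊑ stage k
hPow-⊑-stage zero    = [] , refl
hPow-⊑-stage (suc k) = morph-⊑-Φ hL≡ (hPow-⊑-stage k)

hPow-⊑-suc : ∀ k → hPow k ⊑ hPow (suc k)
hPow-⊑-suc zero    = [ 1₃ ] , refl
hPow-⊑-suc (suc k) = morph-⊑ hL (hPow-⊑-suc k)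

morph-length : {A B : Set} (σ : A → List B) (k : ℕ) → (∀ a → k ≤ length (σ a)) → ∀ x → length x * k ≤ length (morph σ x)
morph-length σ k k≤ []      = z≤n
morph-length σ k k≤ (a ∷ x) = ≤-trans (+-mono-≤ (k≤ a) (morph-length σ k k≤ x)) (≤-reflexive (sym (length-++ (σ a))))

morph-nonerasing : {A B : Set} (σ : A → List B) → (∀ a → 1 ≤ length (σ a)) → ∀ x → length x ≤ length (morph σ x)
morph-nonerasing σ 1≤ x = ≤-trans (≤-reflexive (sym (*-identityʳ (length x)))) (morph-length σ 1 1≤ x)

-- Every image under `hL` has at least two letters, so the length at least doubles.
hPow-length : ∀ k → k < length (hPow k)
hPow-length zero    = ≤-refl
hPow-length (suc k) = ≤-trans (m<m*n (suc k) 2 ≤-refl) (≤-trans (*-monoˡ-≤ 2 (hPow-length k))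
  (morph-length hL 2 (from-yes (Fin.all? λ a → 2 ≤? length (hL a))) (hPow k)))

nthD-⊑ : {A : Set} (d : A) {u w : List A} → u ⊑ w → ∀ i → i < length u → nthD d w i ≡ nthD d u i
nthD-⊑ d {_ ∷ _} (_ , refl) zero    _         = refl
nthD-⊑ d {_ ∷ u} (e , refl) (suc i) (s≤s i<u) = nthD-⊑ d {u} (e , refl) i i<u

applyUpTo-cong : {A : Set} {x y : ℕ → A} → ∀ n → (∀ k → k < n → x k ≡ y k) → applyUpTo x n ≡ applyUpTo y n
applyUpTo-cong zero    x≡y = refl
applyUpTo-cong (suc n) x≡y = cong₂ _∷_ (x≡y 0 (s≤s z≤n)) (applyUpTo-cong n λ k k<n → x≡y (suc k) (s≤s k<n))

nthD-take : {A : Set} (d : A) (w : List A) → ∀ n → n ≤ length w → applyUpTo (nthD d w) n ⊑ w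
nthD-take d w       zero    _        = w , refl
nthD-take d (a ∷ w) (suc n) (s≤s le) with nthD-take d w n le
... | r , eq = r , cong (a ∷_) eq

nthD-factor : {A : Set} (d : A) (w : List A) → ∀ i n → i + n ≤ length w →
              IsFactor (applyUpTo (λ k → nthD d w (i + k)) n) w
nthD-factor d w       zero    n le = [] , nthD-take d w n le
nthD-factor d (a ∷ w) (suc i) n (s≤s le) with nthD-factor d w i n le
... | p , r , eq = a ∷ p , r , cong (a ∷_) eq
nthD-factor d []      (suc i) n ()

module _ {A : Set} (d : A) (w : ℕ → List A) (w-⊑ : ∀ k → w k ⊑ w (suc k)) (w-length : ∀ k → k ≤ length (w k)) where

  limit : InfWord A
  limit i = nthD d (w (suc i)) i

  ⊑-later : ∀ k j → w k ⊑ w (k + j)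
  ⊑-later k zero    = [] , trans (++-identityʳ (w k)) (cong w (sym (+-identityʳ k)))
  ⊑-later k (suc j) = ⊑-trans (⊑-later k j) (subst (λ m → w (k + j) ⊑ w m) (sym (+-suc k j)) (w-⊑ (k + j)))

  -- Stage `suc i` has more than `i` letters and later stages extend it, so position `i` no longer
  -- changes and the default is never read.
  limit-stable : ∀ {i m} → i < m → limit i ≡ nthD d (w m) i
  limit-stable {i} i<m with m≤n⇒∃[o]m+o≡n i<m
  ... | j , refl = sym (nthD-⊑ d (⊑-later (suc i) j) i (w-length (suc i)))

  slice-factor : ∀ i n → IsFactor (slice limit i n) (w (i + n))
  slice-factor i n = subst (λ u → IsFactor u (w (i + n)))
    (sym (trans (map-upTo (λ k → limit (i + k)) n)
      (applyUpTo-cong n λ k k<n → limit-stable (+-monoʳ-< i k<n))))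
    (nthD-factor d (w (i + n)) i n (w-length (i + n)))

module _ {n} {w : ℕ → List (Fin n)} {x : ℕ → List (Fin n)} where

  -- Each slice of the limit is a factor of some `w k`, hence of `x k`, the word with closing marker
  -- for which returns are known.
  rich-limit : ∀ d (w-⊑ : ∀ k → w k ⊑ w (suc k)) (w-length : ∀ k → k ≤ length (w k)) →
               (∀ k → w k ⊑ x k) → (∀ k → Returns anywhere (x k)) → RichInf (limit d w w-⊑ w-length)
  rich-limit d w-⊑ w-length w⊑x returns i m with slice-factor d w w-⊑ w-length i m | w⊑x (i + m)
  ... | p , r , eq | e , eq′ = Richness.rich-factor (x (i + m)) (returns (i + m)) p _ (r ++ e)
    (trans (trans (cong (p ++_) (sym (++-assoc _ r e))) (sym (++-assoc p _ e))) (trans (cong (_++ e) eq) eq′))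

fL-nonerasing : ∀ a → 1 ≤ length (fL a)
fL-nonerasing = from-yes (Fin.all? λ a → 1 ≤? length (fL a))

gL-nonerasing : ∀ a → 1 ≤ length (gL a)
gL-nonerasing = from-yes (Fin.all? λ a → 1 ≤? length (gL a))

hPow-length-≤ : ∀ k → k ≤ length (hPow k)
hPow-length-≤ k = ≤-trans (n≤1+n k) (hPow-length k)

theorem15 : RichInf fhω × RichInf fghω
theorem15 =
    rich-limit 0₂ (λ k → morph-⊑ fL (hPow-⊑-suc k))
      (λ k → ≤-trans (hPow-length-≤ k) (morph-nonerasing fL fL-nonerasing (hPow k)))
      (λ k → morph-⊑-Φ fL≡ (hPow-⊑-stage k))
      (λ k → F.Φ-returns anywhere F-admissible-anywhere (stage-invariant k))
  , rich-limit 0₂ (λ k → morph-⊑ fL (morph-⊑ gL (hPow-⊑-suc k)))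
      (λ k → ≤-trans (hPow-length-≤ k) (≤-trans (morph-nonerasing gL gL-nonerasing (hPow k))
        (morph-nonerasing fL fL-nonerasing (g (hPow k)))))
      (λ k → morph-⊑-Φ fL≡ (morph-⊑-Φ gL≡ (hPow-⊑-stage k)))
      -- The word `G.Φ (stage k)` satisfies `Invariant` again, so f applies to it as it did to
      -- `stage k`.
      (λ k → F.Φ-returns anywhere F-admissible-anywhere
        ( G.Φ-returns anywhere G-admissible-anywhere (stage-invariant k)
        , G.Φ-returns nonzero G-admissible-nonzero (stage-invariant k) ))
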